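{- Let $r\geq 1$ be an integer and let $x$ be a formal variable. Then \[ \sum_{T} \; \prod_{v \in T} \big(x\, h_T(v) + 1 \big) = (x+1) \prod_{i=1}^{r-1} (r x + i), \] where the sum runs over all unordered increasing trees $T$ with $r$ vertices, the product on the left runs over all vertices $v$ of $T$ (including the root), and $h_T(v)$ is the size of the hook of $v$ in $T$.
   Context: A rooted tree is a tree (acyclic connected graph) with a distinguished vertex, the root. Each edge joins a father (the endpoint closer to the root) to a son (the endpoint farther from the root). The descendants of a vertex are its sons and, recursively, the descendants of its sons. The hook of a vertex $v$ in $T$ is the set consisting of $v$ and all its descendants, and $h_T(v)$ is its cardinality. An unordered increasing tree with $r$ vertices is a rooted tree whose vertices are labelled by $1,\dots,r$ (each label used exactly once) such that the label of a son is always bigger than the label of its father (so the root has label $1$), and where the sons of a given vertex are not ordered. Thus such a tree is determined by its father function $f:\{2,\dots,r\}\to\{1,\dots,r\}$ with $f(v)<v$ for all $v$. An empty product is $1$. -}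

module Defs where

open import Data.Fin using (Fin; toℕ; fromℕ; inject₁; _<_)
open import Data.Fin.Induction using (<-wellFounded)
open import Data.Fin.Properties using (_≟_; toℕ-fromℕ; toℕ-inject₁; toℕ<n)
open import Data.Fin.Relation.Unary.Top using (view; ‵fromℕ; ‵inject₁)
open import Data.Integer using (ℤ; 0ℤ; 1ℤ; +_)
import Data.Integer as ℤ
open import Data.List using (List; []; _∷_; map; concatMap; filter; length; foldr; allFin)
open import Data.Maybe using (Maybe; just; nothing)
import Data.Maybe as Maybe
open import Data.Maybe.Properties using (just-injective)
open import Data.Nat using (ℕ; zero; suc)
import Data.Nat as ℕ
open import Data.Sum using (_⊎_; inj₁; inj₂)
open import Induction.WellFounded using (Acc; acc)
open import Relation.Binary.Construct.Closure.Transitive using (TransClosure; [_]; _∷_; _∷ʳ_)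
open import Relation.Binary.PropositionalEquality
  using (_≡_; refl; sym; trans; subst; subst₂)
open import Relation.Nullary using (Dec; yes; no; ¬_)

------------------------------------------------------------------------
-- ℤ[x]

-- The constant coefficient comes first.  Trailing zeros are allowed, so
-- polynomials are compared with _≈_ rather than _≡_.

Poly : Set
Poly = List ℤ

coeff : Poly → ℕ → ℤ
coeff []      _       = 0ℤ
coeff (a ∷ p) zero    = a
coeff (a ∷ p) (suc k) = coeff p k

infix  4 _≈_
infixl 6 _+_
infixl 7 _*_

_≈_ : Poly → Poly → Set
p ≈ q = ∀ k → coeff p k ≡ coeff q k

_+_ : Poly → Poly → Poly
[]      + q       = q
(a ∷ p) + []      = a ∷ p
(a ∷ p) + (b ∷ q) = (a ℤ.+ b) ∷ (p + q)

-- (a + x p) q = a q + x (p q)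
_*_ : Poly → Poly → Poly
[]      * q = []
(a ∷ p) * q = map (a ℤ.*_) q + (0ℤ ∷ (p * q))

x : Poly
x = 0ℤ ∷ 1ℤ ∷ []

const : ℕ → Poly
const n = + n ∷ []

∑ ∏ : ∀ {A : Set} → List A → (A → Poly) → Poly
∑ as f = foldr (λ a p → f a + p) (const 0) as
∏ as f = foldr (λ a p → f a * p) (const 1) as

------------------------------------------------------------------------
-- Increasing trees

-- A vertex v : Fin r carries the label toℕ v + 1.  The father function
-- f : {2,…,r} → {1,…,r} with f(v) < v is stored as the sequence
-- f(2), f(3), …, f(r):  t ◂ p  extends the tree t on r vertices by a vertex
-- labelled r + 1 whose father is p, which may be any of the r vertices of t.

infixl 5 _◂_

data IncreasingTree : ℕ → Set where
  root : IncreasingTree 1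
  _◂_  : ∀ {r} → IncreasingTree r → Fin r → IncreasingTree (suc r)

allTrees : ∀ r → List (IncreasingTree r)
allTrees 0             = []
allTrees 1             = root ∷ []
allTrees (suc (suc n)) =
  concatMap (λ t → map (t ◂_) (allFin (suc n))) (allTrees (suc n))

father : ∀ {r} → IncreasingTree r → Fin r → Maybe (Fin r)
father root    _ = nothing
father (t ◂ p) v with view v
... | ‵fromℕ     = just (inject₁ p)
... | ‵inject₁ u = Maybe.map inject₁ (father t u)

father-< : ∀ {r} (t : IncreasingTree r) {u v} → father t v ≡ just u → u < v
father-< (t ◂ p) {v = v} eq with view v
father-< {suc r} (t ◂ p) refl | ‵fromℕ =
  subst₂ ℕ._<_ (sym (toℕ-inject₁ p)) (sym (toℕ-fromℕ r)) (toℕ<n p)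
father-< (t ◂ p) eq | ‵inject₁ w with father t w in eq′
father-< (t ◂ p) refl | ‵inject₁ w | just u =
  subst₂ ℕ._<_ (sym (toℕ-inject₁ u)) (sym (toℕ-inject₁ w)) (father-< t eq′)

module _ {r} (t : IncreasingTree r) where

  _HasSon_ : Fin r → Fin r → Set
  v HasSon w = father t w ≡ just v

  _HasDescendant_ : Fin r → Fin r → Set
  _HasDescendant_ = TransClosure _HasSon_

  InHook : Fin r → Fin r → Set
  InHook v w = w ≡ v ⊎ v HasDescendant w

  private
    data LastStep (v w : Fin r) : Set where
      last : ∀ {u} → u HasSon w → InHook v u → LastStep v w

    lastStep : ∀ {v w} → v HasDescendant w → LastStep v w
    lastStep [ s ] = last s (inj₁ refl)
    lastStep (s ∷ d) with lastStep d
    ... | last s′ (inj₁ refl) = last s′ (inj₂ [ s ])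
    ... | last s′ (inj₂ d′)   = last s′ (inj₂ (s ∷ d′))

    inHook-acc : ∀ v w → Acc _<_ w → Dec (InHook v w)
    inHook-acc v w (acc rec) with w ≟ v
    ... | yes w≡v = yes (inj₁ w≡v)
    ... | no  w≢v with father t w in eq
    ...   | nothing = no λ where
            (inj₁ w≡v) → w≢v w≡v
            (inj₂ d)   → case-last (lastStep d)
      where
      case-last : ¬ LastStep v w
      case-last (last s _) with trans (sym eq) s
      ... | ()
    ...   | just u with inHook-acc v u (rec (father-< t eq))
    ...     | yes (inj₁ refl) = yes (inj₂ [ eq ])
    ...     | yes (inj₂ d)    = yes (inj₂ (d ∷ʳ eq))
    ...     | no  u∉          = no λ where
              (inj₁ w≡v) → w≢v w≡v
              (inj₂ d)   → case-last (lastStep d)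
      where
      case-last : ¬ LastStep v w
      case-last (last s h) =
        u∉ (subst (InHook v) (just-injective (trans (sym s) eq)) h)

  inHook? : ∀ v w → Dec (InHook v w)
  inHook? v w = inHook-acc v w (<-wellFounded w)

  hook : Fin r → List (Fin r)
  hook v = filter (inHook? v) (allFin r)

  h : Fin r → ℕ
  h v = length (hook v)

{-# OPTIONS --safe #-}
-- Give each vertex w a weight y_w, and write W_v for the total weight of the
-- hook of v.  Attaching a new leaf of weight z to p has the same effect on the
-- old hooks as replacing y_p by y_p + z, and the new hook contributes 1 + z.
-- Hence the weighted sums satisfy a recursion in the weights alone, and
-- induction on r shows
--   Σ_T ∏_v (1 + W_v) = (1 + y_r) ∏_{1≤k<r} (k (1 + y_k) + y_{k+1} + … + y_r).
-- All weights equal to x gives the hook formula.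
module Submission where

open import Algebra using (CommutativeMonoid; CommutativeSemiring)
open import Algebra.Structures using (IsCommutativeMonoid)
open import Algebra.Structures.Biased using (isCommutativeSemiringʳ)
import Algebra.Properties.Semiring.Sum as SemiringSum
import Algebra.Properties.CommutativeMonoid.Sum as MonoidSum
import Algebra.Properties.Monoid.Mult as Mult
import Algebra.Solver.Ring.NaturalCoefficients.Default as Solver
open import Data.Bool using (Bool; true; false; if_then_else_)
open import Data.Fin as Fin using (Fin; zero; suc; toℕ; fromℕ; inject₁)
import Data.Fin.Properties as Fin
open import Data.Fin.Relation.Unary.Top
  using (view; view-fromℕ; view-inject₁; ‵fromℕ; ‵inject₁)
open import Data.Integer using (ℤ; 0ℤ; 1ℤ)
import Data.Integer as ℤ
import Data.Integer.Properties as ℤ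
open import Data.List
  using (List; []; _∷_; _++_; _∷ʳ_; map; concatMap; filter; length; foldr; allFin; tabulate; upTo)
open import Data.List.Properties using (upTo-∷ʳ)
open import Data.Maybe as Maybe using (Maybe; just)
open import Data.Nat as ℕ using (ℕ; zero; suc; _≥_; _∸_)
import Data.Nat.Properties as ℕ
open import Data.Product using (_,_)
open import Data.Sum using (inj₁; inj₂)
open import Data.Vec.Functional using (Vector; init; last; updateAt)
open import Defs
  using (IncreasingTree; root; _◂_; allTrees; father; father-<; InHook; inHook?; h
        ; _HasSon_; _HasDescendant_)
open import Function using (_∘_; mk⇔)
open import Level using (Level)
open import Relation.Binary.Construct.Closure.Transitive as Plus using ([_]; _∷_)
open import Relation.Binary.PropositionalEquality as ≡ using (_≡_; _≗_; cong; cong₂; subst)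
open import Relation.Nullary using (does; yes; no; ¬_)
open import Relation.Nullary.Decidable using (dec-true; dec-false; does-⇔)
open import Relation.Unary using (Pred; Decidable)

private
  variable
    a p : Level
    A B : Set a
    r n : ℕ

-- Hooks and the attachment of a leaf

inHook-trans : ∀ (t : IncreasingTree r) {u v w} → InHook t u v → InHook t v w → InHook t u w
inHook-trans t (inj₁ ≡.refl) d             = d
inHook-trans t (inj₂ c)      (inj₁ ≡.refl) = inj₂ c
inHook-trans t (inj₂ c)      (inj₂ d)      = inj₂ (c Plus.++ d)

descendant⇒< : ∀ (t : IncreasingTree r) {v w} → _HasDescendant_ t v w → v Fin.< w
descendant⇒< t [ s ]   = father-< t s
descendant⇒< t (s ∷ d) = ℕ.<-trans (father-< t s) (descendant⇒< t d)

inHook⇒≤ : ∀ (t : IncreasingTree r) {v w} → InHook t v w → v Fin.≤ w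
inHook⇒≤ t (inj₁ ≡.refl) = ℕ.≤-refl
inHook⇒≤ t (inj₂ d)      = ℕ.<⇒≤ (descendant⇒< t d)

module _ {r} (t : IncreasingTree r) (p : Fin r) where

  father-top : father (t ◂ p) (fromℕ r) ≡ just (inject₁ p)
  father-top rewrite view-fromℕ r = ≡.refl

  father-inject₁ : ∀ v → father (t ◂ p) (inject₁ v) ≡ Maybe.map inject₁ (father t v)
  father-inject₁ v rewrite view-inject₁ v = ≡.refl

  -- Collapsing the new leaf onto its father is a retraction of `inject₁` that respects hooks. It
  -- pulls hook membership in `t ◂ p` back to `t`, the converse of the inclusion `inject₁-inHook`.
  contract : Fin (suc r) → Fin r
  contract v with view v
  ... | ‵fromℕ     = p
  ... | ‵inject₁ u = u

  contract-inject₁ : ∀ v → contract (inject₁ v) ≡ v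
  contract-inject₁ v rewrite view-inject₁ v = ≡.refl

  contract-top : contract (fromℕ r) ≡ p
  contract-top rewrite view-fromℕ r = ≡.refl

  -- The edge from `p` to the leaf shrinks to a point and every other edge is an edge of `t`; hence
  -- the conclusion is `InHook`, which admits equality.
  contract-son : ∀ {v} w → _HasSon_ (t ◂ p) v w → InHook t (contract v) (contract w)
  contract-son w s with view w
  contract-son _ ≡.refl | ‵fromℕ = inj₁ (≡.sym (contract-inject₁ p))
  contract-son _ s | ‵inject₁ w with father t w in eq
  contract-son _ ≡.refl | ‵inject₁ w | just u =
    inj₂ [ ≡.trans eq (cong just (≡.sym (contract-inject₁ u))) ]

  contract-descendant : ∀ {v w} → _HasDescendant_ (t ◂ p) v w → InHook t (contract v) (contract w)
  contract-descendant {w = w} [ s ] = contract-son w s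
  contract-descendant (_∷_ {y = u} s d) = inHook-trans t (contract-son u s) (contract-descendant d)

  contract-inHook : ∀ {v w} → InHook (t ◂ p) v w → InHook t (contract v) (contract w)
  contract-inHook (inj₁ ≡.refl) = inj₁ ≡.refl
  contract-inHook (inj₂ d)      = contract-descendant d

  inject₁-son : ∀ {v w} → _HasSon_ t v w → _HasSon_ (t ◂ p) (inject₁ v) (inject₁ w)
  inject₁-son {w = w} s = ≡.trans (father-inject₁ w) (cong (Maybe.map inject₁) s)

  inject₁-descendant : ∀ {v w} → _HasDescendant_ t v w →
                       _HasDescendant_ (t ◂ p) (inject₁ v) (inject₁ w)
  inject₁-descendant [ s ]   = [ inject₁-son s ]
  inject₁-descendant (s ∷ d) = inject₁-son s ∷ inject₁-descendant d

  inject₁-inHook : ∀ {v w} → InHook t v w → InHook (t ◂ p) (inject₁ v) (inject₁ w)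
  inject₁-inHook (inj₁ ≡.refl) = inj₁ ≡.refl
  inject₁-inHook (inj₂ d)      = inj₂ (inject₁-descendant d)

  inHook?-inject₁ : ∀ v w →
    does (inHook? (t ◂ p) (inject₁ v) (inject₁ w)) ≡ does (inHook? t v w)
  inHook?-inject₁ v w = does-⇔
    (mk⇔ (≡.subst₂ (InHook t) (contract-inject₁ v) (contract-inject₁ w) ∘ contract-inHook)
         inject₁-inHook)
    (inHook? (t ◂ p) (inject₁ v) (inject₁ w)) (inHook? t v w)

  -- Contraction sends the leaf to `p`; conversely, a hook containing `p` extends along the new
  -- edge. This is why the weight of the leaf can be moved to `p`.
  inHook?-top : ∀ v → does (inHook? (t ◂ p) (inject₁ v) (fromℕ r)) ≡ does (inHook? t v p)
  inHook?-top v = does-⇔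
    (mk⇔ (≡.subst₂ (InHook t) (contract-inject₁ v) contract-top ∘ contract-inHook)
         (λ i → inHook-trans (t ◂ p) (inject₁-inHook i) (inj₂ [ father-top ])))
    (inHook? (t ◂ p) (inject₁ v) (fromℕ r)) (inHook? t v p)

  -- Labels never decrease from a vertex to the members of its hook, and the leaf has the largest
  -- label.
  top-hook-∌ : ∀ w → ¬ InHook (t ◂ p) (fromℕ r) (inject₁ w)
  top-hook-∌ w i = ℕ.<⇒≱ (Fin.inject₁ℕ< w)
    (subst (ℕ._≤ toℕ (inject₁ w)) (Fin.toℕ-fromℕ r) (inHook⇒≤ (t ◂ p) i))

-- The weighted hook formula in a commutative semiring

module Weighted {c ℓ} (R : CommutativeSemiring c ℓ) where

  open CommutativeSemiring R hiding (zero)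
  open SemiringSum semiring
  module Prod = MonoidSum *-commutativeMonoid
  open Mult +-monoid using (_×_)
  open Solver R using (solve; _:=_; _:+_; _:*_; con)
  open import Relation.Binary.Reasoning.Setoid setoid

  ι : ℕ → Carrier
  ι n = n × 1#

  -- Sums and products over lists

  ∑ ∏ : List A → (A → Carrier) → Carrier
  ∑ as f = foldr (λ a s → f a + s) 0# as
  ∏ as f = foldr (λ a s → f a * s) 1# as

  ∑-cong : ∀ (as : List A) {f g : A → Carrier} → (∀ a → f a ≈ g a) → ∑ as f ≈ ∑ as g
  ∑-cong []       f≈g = refl
  ∑-cong (a ∷ as) f≈g = +-cong (f≈g a) (∑-cong as f≈g)

  ∏-cong : ∀ (as : List A) {f g : A → Carrier} → (∀ a → f a ≈ g a) → ∏ as f ≈ ∏ as g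
  ∏-cong []       f≈g = refl
  ∏-cong (a ∷ as) f≈g = *-cong (f≈g a) (∏-cong as f≈g)

  ∑-map : ∀ (g : A → B) as f → ∑ (map g as) f ≈ ∑ as (f ∘ g)
  ∑-map g []       f = refl
  ∑-map g (a ∷ as) f = +-congˡ (∑-map g as f)

  ∑-++ : ∀ (as bs : List A) f → ∑ (as ++ bs) f ≈ ∑ as f + ∑ bs f
  ∑-++ []       bs f = sym (+-identityˡ _)
  ∑-++ (a ∷ as) bs f = trans (+-congˡ (∑-++ as bs f)) (sym (+-assoc _ _ _))

  ∏-∷ʳ : ∀ (as : List A) a f → ∏ (as ∷ʳ a) f ≈ f a * ∏ as f
  ∏-∷ʳ []       a f = refl
  ∏-∷ʳ (b ∷ as) a f = trans (*-congˡ (∏-∷ʳ as a f))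
    (solve 3 (λ b a s → b :* (a :* s) := a :* (b :* s)) refl (f b) (f a) (∏ as f))

  ∑-concatMap : ∀ (g : A → List B) as f → ∑ (concatMap g as) f ≈ ∑ as (λ a → ∑ (g a) f)
  ∑-concatMap g []       f = refl
  ∑-concatMap g (a ∷ as) f = trans (∑-++ (g a) _ f) (+-congˡ (∑-concatMap g as f))

  ∑-tabulate : ∀ (g : Fin n → A) f → ∑ (tabulate g) f ≈ sum (f ∘ g)
  ∑-tabulate {zero}  g f = refl
  ∑-tabulate {suc n} g f = +-congˡ (∑-tabulate (g ∘ suc) f)

  ∏-tabulate : ∀ (g : Fin n → A) f → ∏ (tabulate g) f ≈ Prod.sum (f ∘ g)
  ∏-tabulate {zero}  g f = refl
  ∏-tabulate {suc n} g f = *-congˡ (∏-tabulate (g ∘ suc) f)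

  ∑-distribˡ : ∀ (as : List A) x f → ∑ as (λ a → x * f a) ≈ x * ∑ as f
  ∑-distribˡ []       x f = sym (zeroʳ x)
  ∑-distribˡ (a ∷ as) x f = trans (+-congˡ (∑-distribˡ as x f)) (sym (distribˡ x _ _))

  ∑-sum-swap : ∀ (as : List A) (f : A → Fin n → Carrier) →
               ∑ as (λ a → sum (f a)) ≈ sum (λ i → ∑ as (λ a → f a i))
  ∑-sum-swap {n = n} []       f = sym (sum-replicate-zero n)
  ∑-sum-swap         (a ∷ as) f =
    trans (+-congˡ (∑-sum-swap as f)) (sym (∑-distrib-+ (f a) _))

  -- Hook weights

  -- The mask is a `Bool` so that membership in hooks of different trees can be exchanged by an
  -- equality of `does`, whatever the underlying proofs.
  masked : Bool → Carrier → Carrier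
  masked b y = if b then y else 0#

  ∑-masked-const : ∀ {P : Pred A p} (P? : Decidable P) as x →
                   ∑ as (λ a → masked (does (P? a)) x) ≈ x * ι (length (filter P? as))
  ∑-masked-const P? []       x = sym (zeroʳ x)
  ∑-masked-const P? (a ∷ as) x with P? a
  ... | no  _ = trans (+-identityˡ _) (∑-masked-const P? as x)
  ... | yes _ = trans (+-congˡ (∑-masked-const P? as x))
    (solve 2 (λ x l → x :+ x :* l := x :* (con 1 :+ l)) refl x (ι (length (filter P? as))))

  add : Vector Carrier n → Fin n → Carrier → Vector Carrier n
  add y i z = updateAt y i (_+ z)

  sum-masked-add : ∀ (b : Fin n → Bool) y i z →
    sum (λ j → masked (b j) (add y i z j)) ≈ sum (λ j → masked (b j) (y j)) + masked (b i) z
  sum-masked-add b y zero z with b zero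
  ... | true  = solve 3 (λ y z s → (y :+ z) :+ s := (y :+ s) :+ z) refl (y zero) z _
  ... | false = sym (+-identityʳ _)
  sum-masked-add b y (suc i) z =
    trans (+-congˡ (sum-masked-add (b ∘ suc) (y ∘ suc) i z)) (sym (+-assoc _ _ _))

  hookWeight : IncreasingTree r → Vector Carrier r → Fin r → Carrier
  hookWeight t y v = sum (λ w → masked (does (inHook? t v w)) (y w))

  hookWeight-const : ∀ (t : IncreasingTree r) x v → hookWeight t (λ _ → x) v ≈ x * ι (h t v)
  hookWeight-const t x v = trans
    (sym (∑-tabulate (λ w → w) (λ w → masked (does (inHook? t v w)) x)))
    (∑-masked-const (inHook? t v) (allFin _) x)

  module _ (t : IncreasingTree r) (p : Fin r) (y : Vector Carrier (suc r)) where

    -- By `inHook?-top` the term of the leaf is present exactly when that of `p` is, so the two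
    -- weights merge into one at `p`.
    hookWeight-inject₁ : ∀ v →
      hookWeight (t ◂ p) y (inject₁ v) ≈ hookWeight t (add (init y) p (last y)) v
    hookWeight-inject₁ v = begin
      hookWeight (t ◂ p) y (inject₁ v)
        ≈⟨ sum-init-last (λ w → masked (does (inHook? (t ◂ p) (inject₁ v) w)) (y w)) ⟩
      sum (λ w → masked (does (inHook? (t ◂ p) (inject₁ v) (inject₁ w))) (y (inject₁ w)))
        + masked (does (inHook? (t ◂ p) (inject₁ v) (fromℕ _))) (last y)
        ≡⟨ cong₂ _+_
             (sum-cong-≗ λ w → cong (λ b → masked b (init y w)) (inHook?-inject₁ t p v w))
             (cong (λ b → masked b (last y)) (inHook?-top t p v)) ⟩
      sum (λ w → masked (does (inHook? t v w)) (init y w)) + masked (does (inHook? t v p)) (last y)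
        ≈⟨ sum-masked-add (λ w → does (inHook? t v w)) (init y) p (last y) ⟨
      hookWeight t (add (init y) p (last y)) v
        ∎

    hookWeight-top : hookWeight (t ◂ p) y (fromℕ r) ≈ last y
    hookWeight-top = begin
      hookWeight (t ◂ p) y (fromℕ r)
        ≈⟨ sum-init-last (λ w → masked (does (inHook? (t ◂ p) (fromℕ r) w)) (y w)) ⟩
      sum (λ w → masked (does (inHook? (t ◂ p) (fromℕ r) (inject₁ w))) (y (inject₁ w)))
        + masked (does (inHook? (t ◂ p) (fromℕ r) (fromℕ r))) (last y)
        ≡⟨ cong₂ _+_
             (sum-cong-≗ λ w → cong (λ b → masked b (init y w))
               (dec-false (inHook? (t ◂ p) (fromℕ r) (inject₁ w)) (top-hook-∌ t p w)))
             (cong (λ b → masked b (last y))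
               (dec-true (inHook? (t ◂ p) (fromℕ r) (fromℕ r)) (inj₁ ≡.refl))) ⟩
      sum {r} (λ _ → 0#) + last y
        ≈⟨ +-congʳ (sum-replicate-zero r) ⟩
      0# + last y
        ≈⟨ +-identityˡ _ ⟩
      last y
        ∎

  hookProduct : Vector Carrier r → IncreasingTree r → Carrier
  hookProduct y t = Prod.sum (λ v → 1# + hookWeight t y v)

  hookProduct-◂ : ∀ (t : IncreasingTree r) p y →
    hookProduct y (t ◂ p) ≈ (1# + last y) * hookProduct (add (init y) p (last y)) t
  hookProduct-◂ t p y = begin
    hookProduct y (t ◂ p)
      ≈⟨ Prod.sum-init-last (λ v → 1# + hookWeight (t ◂ p) y v) ⟩
    Prod.sum (λ v → 1# + hookWeight (t ◂ p) y (inject₁ v)) * (1# + hookWeight (t ◂ p) y (fromℕ _))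
      ≈⟨ *-cong (Prod.sum-cong-≋ λ v → +-congˡ (hookWeight-inject₁ t p y v))
                (+-congˡ (hookWeight-top t p y)) ⟩
    hookProduct (add (init y) p (last y)) t * (1# + last y)
      ≈⟨ *-comm _ _ ⟩
    (1# + last y) * hookProduct (add (init y) p (last y)) t
      ∎

  -- tailProduct (y₁,…,yₙ) s = ∏ₖ (k (1 + yₖ) + yₖ₊₁ + … + yₙ + s)
  tailProduct : ∀ n → Vector Carrier n → Carrier → Carrier
  tailProduct zero    y s = 1#
  tailProduct (suc n) y s =
    (ι (suc n) * (1# + last y) + s) * tailProduct n (init y) (last y + s)

  tailProduct-cong : ∀ n {y y′ s s′} → (∀ i → y i ≈ y′ i) → s ≈ s′ →
                     tailProduct n y s ≈ tailProduct n y′ s′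
  tailProduct-cong zero    y≈ s≈ = refl
  tailProduct-cong (suc n) y≈ s≈ =
    *-cong (+-cong (*-congˡ (+-congˡ (y≈ _))) s≈)
           (tailProduct-cong n (y≈ ∘ inject₁) (+-cong (y≈ _) s≈))

  -- This and the next three equations separate the increments that only affect `init y` from the
  -- one that only affects `last y`.
  add-inject₁-init : ∀ (y : Vector Carrier (suc n)) i z → init (add y (inject₁ i) z) ≗ add (init y) i z
  add-inject₁-init y zero    z zero    = ≡.refl
  add-inject₁-init y zero    z (suc j) = ≡.refl
  add-inject₁-init y (suc i) z zero    = ≡.refl
  add-inject₁-init y (suc i) z (suc j) = add-inject₁-init (y ∘ suc) i z j

  add-inject₁-last : ∀ (y : Vector Carrier (suc n)) i z → last (add y (inject₁ i) z) ≡ last y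
  add-inject₁-last {suc n} y zero    z = ≡.refl
  add-inject₁-last {suc n} y (suc i) z = add-inject₁-last (y ∘ suc) i z

  add-top-init : ∀ (y : Vector Carrier (suc n)) z → init (add y (fromℕ n) z) ≗ init y
  add-top-init {suc n} y z zero    = ≡.refl
  add-top-init {suc n} y z (suc j) = add-top-init (y ∘ suc) z j

  add-top-last : ∀ (y : Vector Carrier (suc n)) z → last (add y (fromℕ n) z) ≡ last y + z
  add-top-last {zero}  y z = ≡.refl
  add-top-last {suc n} y z = add-top-last (y ∘ suc) z

  -- The common shape of tailProduct (suc n) and of the full product formula.
  module _ (F : Carrier → Carrier) (F-cong : ∀ {s s′} → s ≈ s′ → F s ≈ F s′)
           (S : Carrier → Carrier) (S-cong : ∀ {s s′} → s ≈ s′ → S s ≈ S s′)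
           (y : Vector Carrier (suc n)) (z : Carrier)
           (step : ∀ s → sum (λ i → tailProduct n (add (init y) i z) s)
                         ≈ ι n * tailProduct n (init y) (s + z)) where

    -- The positions split into those below the top and the top itself. Below the top the last
    -- weight is fixed, so `F (last y)` factors out and `step` evaluates the remaining sum; the top
    -- position gives the single term with `last y + z`. Here `F` is the leading factor and `S` the
    -- quantity handed to the tail, both as functions of the last weight.
    sum-add : sum (λ i → F (last (add y i z)) * tailProduct n (init (add y i z)) (S (last (add y i z))))
              ≈ F (last y) * (ι n * tailProduct n (init y) (S (last y) + z))
                + F (last y + z) * tailProduct n (init y) (S (last y + z))
    sum-add = begin
      sum G
        ≈⟨ sum-init-last G ⟩
      sum (init G) + last G
        ≈⟨ +-cong
             (sum-cong-≋ λ i →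
               *-cong (F-cong (reflexive (add-inject₁-last y i z)))
                      (tailProduct-cong n (λ j → reflexive (add-inject₁-init y i z j))
                        (S-cong (reflexive (add-inject₁-last y i z)))))
             (*-cong (F-cong (reflexive (add-top-last y z)))
                     (tailProduct-cong n (λ j → reflexive (add-top-init y z j))
                       (S-cong (reflexive (add-top-last y z))))) ⟩
      sum (λ i → F (last y) * tailProduct n (add (init y) i z) (S (last y))) + Gₜ
        ≈⟨ +-congʳ (*-distribˡ-sum (F (last y)) (λ i → tailProduct n (add (init y) i z) (S (last y)))) ⟨
      F (last y) * sum (λ i → tailProduct n (add (init y) i z) (S (last y))) + Gₜ
        ≈⟨ +-congʳ (*-congˡ (step (S (last y)))) ⟩
      F (last y) * (ι n * tailProduct n (init y) (S (last y) + z)) + Gₜ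
        ∎
      where
      G : Vector Carrier (suc n)
      G i = F (last (add y i z)) * tailProduct n (init (add y i z)) (S (last (add y i z)))
      Gₜ = F (last y + z) * tailProduct n (init y) (S (last y + z))

  -- On average over the `n` positions, adding `z` to a weight acts like adding `z` to `s`. In the
  -- inductive step the positions below the top leave the leading factor alone, while the top
  -- position raises it by `(n + 1) z`: exactly the total needed for `n + 1` factors each raised by
  -- `z`.
  sum-tailProduct : ∀ n (y : Vector Carrier n) z s →
    sum (λ i → tailProduct n (add y i z) s) ≈ ι n * tailProduct n y (s + z)
  sum-tailProduct zero    y z s = sym (zeroˡ _)
  sum-tailProduct (suc n) y z s = begin
    sum (λ i → tailProduct (suc n) (add y i z) s)
      ≈⟨ sum-add (λ l → ι (suc n) * (1# + l) + s) (λ e → +-congʳ (*-congˡ (+-congˡ e)))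
                 (_+ s) +-congʳ y z (sum-tailProduct n (init y) z) ⟩
    (ι (suc n) * (1# + l) + s) * (ι n * tailProduct n (init y) (l + s + z))
      + (ι (suc n) * (1# + (l + z)) + s) * tailProduct n (init y) (l + z + s)
      -- Whether `z` arrives through the induction hypothesis or through the last weight, the tail
      -- receives the same total `l + (s + z)`, so both terms share the factor `q`.
      ≈⟨ +-cong (*-congˡ (*-congˡ (tail≈ (+-assoc l s z))))
                (*-congˡ (tail≈ (trans (+-assoc l z s) (+-congˡ (+-comm z s))))) ⟩
    (ι (suc n) * (1# + l) + s) * (ι n * q) + (ι (suc n) * (1# + (l + z)) + s) * q
      ≈⟨ solve 5 (λ k l z s q →
           ((con 1 :+ k) :* (con 1 :+ l) :+ s) :* (k :* q)
             :+ ((con 1 :+ k) :* (con 1 :+ (l :+ z)) :+ s) :* q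
           := (con 1 :+ k) :* (((con 1 :+ k) :* (con 1 :+ l) :+ (s :+ z)) :* q))
           refl (ι n) l z s q ⟩
    ι (suc n) * tailProduct (suc n) y (s + z)
      ∎
    where
    l = last y
    q = tailProduct n (init y) (l + (s + z))
    tail≈ : ∀ {s s′} → s ≈ s′ → tailProduct n (init y) s ≈ tailProduct n (init y) s′
    tail≈ = tailProduct-cong n (λ _ → refl)

  weightedHookFormula : ∀ n (y : Vector Carrier (suc n)) →
    ∑ (allTrees (suc n)) (hookProduct y) ≈ (1# + last y) * tailProduct n (init y) (last y)
  weightedHookFormula zero y = begin
    (1# + (masked (does (inHook? root zero zero)) (y zero) + 0#)) * 1# + 0#
      ≡⟨ cong (λ b → (1# + (masked b (y zero) + 0#)) * 1# + 0#)
              (dec-true (inHook? root zero zero) (inj₁ ≡.refl)) ⟩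
    (1# + (y zero + 0#)) * 1# + 0#
      ≈⟨ trans (+-identityʳ _) (*-congʳ (+-congˡ (+-identityʳ _))) ⟩
    (1# + y zero) * 1#
      ∎
  weightedHookFormula (suc n) y = begin
    ∑ (allTrees (suc (suc n))) (hookProduct y)
      ≈⟨ ∑-concatMap (λ t → map (t ◂_) (allFin (suc n))) ts (hookProduct y) ⟩
    ∑ ts (λ t → ∑ (map (t ◂_) (allFin (suc n))) (hookProduct y))
      ≈⟨ ∑-cong ts (λ t → trans (∑-map (t ◂_) (allFin (suc n)) (hookProduct y))
                         (trans (∑-tabulate (λ p → p) (λ p → hookProduct y (t ◂ p)))
                                (sum-cong-≋ λ p → hookProduct-◂ t p y))) ⟩
    ∑ ts (λ t → sum (λ p → (1# + z) * hookProduct (add (init y) p z) t))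
      -- The modified weights depend on the father `p`, so `p` must be fixed outside the sum over
      -- trees before the induction hypothesis applies.
      ≈⟨ ∑-sum-swap ts (λ t p → (1# + z) * hookProduct (add (init y) p z) t) ⟩
    sum (λ p → ∑ ts (λ t → (1# + z) * hookProduct (add (init y) p z) t))
      ≈⟨ sum-cong-≋ (λ p → trans (∑-distribˡ ts (1# + z) (hookProduct (add (init y) p z)))
                                 (*-congˡ (weightedHookFormula n (add (init y) p z)))) ⟩
    sum (λ p → (1# + z) * H p)
      ≈⟨ *-distribˡ-sum (1# + z) H ⟨
    (1# + z) * sum H
      ≈⟨ *-congˡ (sum-add (1# +_) +-congˡ (λ l → l) (λ e → e)
                          (init y) z (sum-tailProduct n (init (init y)) z)) ⟩
    (1# + z) * ((1# + l) * (ι n * q) + (1# + (l + z)) * q)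
      -- The `n` lower positions contribute `1 + l` each and the top one `1 + l + z`; together they
      -- form the leading factor `(n + 1)(1 + l) + z` of `tailProduct (suc n)`.
      ≈⟨ *-congˡ (solve 4 (λ k l z q →
           (con 1 :+ l) :* (k :* q) :+ (con 1 :+ (l :+ z)) :* q
           := ((con 1 :+ k) :* (con 1 :+ l) :+ z) :* q)
           refl (ι n) l z q) ⟩
    (1# + z) * tailProduct (suc n) (init y) z
      ∎
    where
    ts = allTrees (suc n)
    z = last y
    l = last (init y)
    q = tailProduct n (init (init y)) (l + z)
    H : Vector Carrier (suc n)
    H p = (1# + last (add (init y) p z))
          * tailProduct n (init (add (init y) p z)) (last (add (init y) p z))

  -- Equal weights

  -- The factor with index `k` is `k (1 + x) + (n - k) x + j x = (j + n) x +
  -- k`. Stripping a factor lowers `n` and adds one `x` to the accumulator, so the induction runs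
  -- over all `j` with `j + n` constant.
  tailProduct-const : ∀ n j x →
    tailProduct n (λ _ → x) (ι j * x) ≈ ∏ (upTo n) (λ i → ι (j ℕ.+ n) * x + ι (suc i))
  tailProduct-const zero    j x = refl
  tailProduct-const (suc n) j x = begin
    (ι (suc n) * (1# + x) + ι j * x) * tailProduct n (λ _ → x) (x + ι j * x)
      ≈⟨ *-cong
           (trans (solve 3 (λ m j x → m :* (con 1 :+ x) :+ j :* x := (j :+ m) :* x :+ m)
                     refl (ι (suc n)) (ι j) x)
                  (+-congʳ (*-congʳ (sym (×-homo-+ 1# j (suc n))))))
           (tailProduct-cong n (λ _ → refl)
             (solve 2 (λ j x → x :+ j :* x := (con 1 :+ j) :* x) refl (ι j) x)) ⟩
    f n * tailProduct n (λ _ → x) (ι (suc j) * x)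
      ≈⟨ *-congˡ (tailProduct-const n (suc j) x) ⟩
    f n * ∏ (upTo n) (λ i → ι (suc j ℕ.+ n) * x + ι (suc i))
      ≡⟨ cong (λ m → f n * ∏ (upTo n) (λ i → ι m * x + ι (suc i))) (ℕ.+-suc j n) ⟨
    f n * ∏ (upTo n) f
      -- `tailProduct` strips the factor of largest index first, which is the last entry of
      -- `upTo (suc n)`.
      ≈⟨ ∏-∷ʳ (upTo n) n f ⟨
    ∏ (upTo n ∷ʳ n) f
      ≡⟨ cong (λ is → ∏ is f) (upTo-∷ʳ n) ⟩
    ∏ (upTo (suc n)) f
      ∎
    where
    open Mult +-monoid using (×-homo-+)
    f : ℕ → Carrier
    f i = ι (j ℕ.+ suc n) * x + ι (suc i)

  hookFormula : ∀ n x →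
    ∑ (allTrees (suc n)) (λ t → ∏ (allFin (suc n)) (λ v → x * ι (h t v) + 1#))
      ≈ (x + 1#) * ∏ (upTo n) (λ i → ι (suc n) * x + ι (suc i))
  hookFormula n x = begin
    ∑ (allTrees (suc n)) (λ t → ∏ (allFin (suc n)) (λ v → x * ι (h t v) + 1#))
      ≈⟨ ∑-cong (allTrees (suc n)) (λ t →
           trans (∏-cong (allFin (suc n)) (λ v →
                   trans (+-congʳ (sym (hookWeight-const t x v))) (+-comm _ 1#)))
                 (∏-tabulate (λ v → v) (λ v → 1# + hookWeight t (λ _ → x) v))) ⟩
    ∑ (allTrees (suc n)) (hookProduct (λ _ → x))
      ≈⟨ weightedHookFormula n (λ _ → x) ⟩
    (1# + x) * tailProduct n (λ _ → x) x
      ≈⟨ *-cong (+-comm 1# x)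
                (tailProduct-cong n (λ _ → refl)
                  -- `1# + 0#` is the unfolding of `ι 1`. The accumulator starts at one `x`, the
                  -- weight of the last vertex, so `j = 1` and the coefficient becomes `1 + n`, the
                  -- number of vertices.
                  (solve 1 (λ x → x := (con 1 :+ con 0) :* x) refl x)) ⟩
    (x + 1#) * tailProduct n (λ _ → x) (ι 1 * x)
      ≈⟨ *-congˡ (tailProduct-const n 1 x) ⟩
    (x + 1#) * ∏ (upTo n) (λ i → ι (suc n) * x + ι (suc i))
      ∎

-- The semiring ℤ[x]

open import Defs using (Poly; coeff; _+_; _*_; _≈_; x; const; ∑; ∏)

infix 4 _≋_

-- A record around _≈_, so that the two polynomials can be inferred from a proof.
record _≋_ (p q : Poly) : Set where
  constructor coeffs
  field coeff-≡ : p ≈ q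

open _≋_

≋-refl : ∀ {p} → p ≋ p
≋-refl .coeff-≡ k = ≡.refl

≋-sym : ∀ {p q} → p ≋ q → q ≋ p
≋-sym e .coeff-≡ k = ≡.sym (coeff-≡ e k)

≋-trans : ∀ {p q r} → p ≋ q → q ≋ r → p ≋ r
≋-trans e f .coeff-≡ k = ≡.trans (coeff-≡ e k) (coeff-≡ f k)

scale : ℤ → Poly → Poly
scale a = map (a ℤ.*_)

coeff-+ : ∀ p q k → coeff (p + q) k ≡ coeff p k ℤ.+ coeff q k
coeff-+ []      q       k       = ≡.sym (ℤ.+-identityˡ _)
coeff-+ (a ∷ p) []      k       = ≡.sym (ℤ.+-identityʳ _)
coeff-+ (a ∷ p) (b ∷ q) zero    = ≡.refl
coeff-+ (a ∷ p) (b ∷ q) (suc k) = coeff-+ p q k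

coeff-scale : ∀ a p k → coeff (scale a p) k ≡ a ℤ.* coeff p k
coeff-scale a []      k       = ≡.sym (ℤ.*-zeroʳ a)
coeff-scale a (b ∷ p) zero    = ≡.refl
coeff-scale a (b ∷ p) (suc k) = coeff-scale a p k

∷-cong : ∀ {a b p q} → a ≡ b → p ≋ q → a ∷ p ≋ b ∷ q
∷-cong a≡b p≋q .coeff-≡ zero    = a≡b
∷-cong a≡b p≋q .coeff-≡ (suc k) = coeff-≡ p≋q k

0∷[]≋[] : 0ℤ ∷ [] ≋ []
0∷[]≋[] .coeff-≡ zero    = ≡.refl
0∷[]≋[] .coeff-≡ (suc k) = ≡.refl

+-cong : ∀ {p p′ q q′} → p ≋ p′ → q ≋ q′ → p + q ≋ p′ + q′
+-cong {p} {p′} {q} {q′} e f .coeff-≡ k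
  rewrite coeff-+ p q k | coeff-+ p′ q′ k = cong₂ ℤ._+_ (coeff-≡ e k) (coeff-≡ f k)

+-assoc : ∀ p q r → (p + q) + r ≋ p + (q + r)
+-assoc p q r .coeff-≡ k
  rewrite coeff-+ (p + q) r k | coeff-+ p q k | coeff-+ p (q + r) k | coeff-+ q r k
  = ℤ.+-assoc (coeff p k) (coeff q k) (coeff r k)

+-comm : ∀ p q → p + q ≋ q + p
+-comm p q .coeff-≡ k
  rewrite coeff-+ p q k | coeff-+ q p k = ℤ.+-comm (coeff p k) (coeff q k)

+-identityˡ : ∀ p → const 0 + p ≋ p
+-identityˡ p = +-cong 0∷[]≋[] (≋-refl {p})

+-identityʳ : ∀ p → p + const 0 ≋ p
+-identityʳ p = ≋-trans (+-comm p (const 0)) (+-identityˡ p)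

-- Taking `const 0` as zero, rather than the equivalent `[]`, makes the sums of `Weighted` unfold to
-- the same folds as those over `Poly`.
+-isCommutativeMonoid : IsCommutativeMonoid _≋_ _+_ (const 0)
+-isCommutativeMonoid = record
  { isMonoid = record
    { isSemigroup = record
      { isMagma = record
        { isEquivalence = record { refl = ≋-refl ; sym = ≋-sym ; trans = ≋-trans }
        ; ∙-cong        = +-cong
        }
      ; assoc = +-assoc
      }
    ; identity = +-identityˡ , +-identityʳ
    }
  ; comm = +-comm
  }

+-commutativeMonoid : CommutativeMonoid _ _
+-commutativeMonoid = record { isCommutativeMonoid = +-isCommutativeMonoid }

open import Algebra.Properties.CommutativeSemigroup
  (CommutativeMonoid.commutativeSemigroup +-commutativeMonoid) using (interchange; x∙yz≈y∙xz)
open import Relation.Binary.Reasoning.Setoid (CommutativeMonoid.setoid +-commutativeMonoid)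

-- Multiplication of polynomials

scale-cong : ∀ a {p q} → p ≋ q → scale a p ≋ scale a q
scale-cong a {p} {q} e .coeff-≡ k
  rewrite coeff-scale a p k | coeff-scale a q k = cong (a ℤ.*_) (coeff-≡ e k)

scale-+ : ∀ a p q → scale a (p + q) ≋ scale a p + scale a q
scale-+ a p q .coeff-≡ k
  rewrite coeff-scale a (p + q) k | coeff-+ p q k | coeff-+ (scale a p) (scale a q) k
        | coeff-scale a p k | coeff-scale a q k
  = ℤ.*-distribˡ-+ a (coeff p k) (coeff q k)

scale-scale : ∀ a b p → scale a (scale b p) ≋ scale (a ℤ.* b) p
scale-scale a b p .coeff-≡ k
  rewrite coeff-scale a (scale b p) k | coeff-scale b p k | coeff-scale (a ℤ.* b) p k
  = ≡.sym (ℤ.*-assoc a b (coeff p k))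

scale-0 : ∀ p → scale 0ℤ p ≋ []
scale-0 p .coeff-≡ k = coeff-scale 0ℤ p k

scale-1 : ∀ p → scale 1ℤ p ≋ p
scale-1 p .coeff-≡ k = ≡.trans (coeff-scale 1ℤ p k) (ℤ.*-identityˡ _)

*-congˡ : ∀ p {q q′} → q ≋ q′ → p * q ≋ p * q′
*-congˡ []      e = ≋-refl
*-congˡ (a ∷ p) e = +-cong (scale-cong a e) (∷-cong ≡.refl (*-congˡ p e))

-- The product is a list of zeros as long as `p`, hence empty only up to `≋`.
*-[] : ∀ p → p * [] ≋ []
*-[] []      = ≋-refl
*-[] (a ∷ p) = ≋-trans (∷-cong ≡.refl (*-[] p)) 0∷[]≋[]

-- The mirror image of the defining recursion of `_*_`; comparing the two yields commutativity.
*-∷ : ∀ p b q → p * (b ∷ q) ≋ scale b p + (0ℤ ∷ p * q)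
*-∷ []      b q = ≋-sym 0∷[]≋[]
*-∷ (a ∷ p) b q = ∷-cong (cong (ℤ._+ 0ℤ) (ℤ.*-comm a b)) (begin
  scale a q + p * (b ∷ q)                ≈⟨ +-cong ≋-refl (*-∷ p b q) ⟩
  scale a q + (scale b p + (0ℤ ∷ p * q)) ≈⟨ x∙yz≈y∙xz (scale a q) (scale b p) _ ⟩
  scale b p + (scale a q + (0ℤ ∷ p * q)) ∎)

*-comm : ∀ p q → p * q ≋ q * p
*-comm []      q = ≋-sym (*-[] q)
*-comm (a ∷ p) q = ≋-sym (≋-trans (*-∷ q a p)
  (+-cong ≋-refl (∷-cong ≡.refl (*-comm q p))))

-- Equivalent left factors may differ in length, which a recursion on them would have to handle;
-- commutativity moves them to the right instead.
*-cong : ∀ {p p′ q q′} → p ≋ p′ → q ≋ q′ → p * q ≋ p′ * q′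
*-cong {p} {p′} {q} {q′} e f = begin
  p * q   ≈⟨ *-congˡ p f ⟩
  p * q′  ≈⟨ *-comm p q′ ⟩
  q′ * p  ≈⟨ *-congˡ q′ e ⟩
  q′ * p′ ≈⟨ *-comm q′ p′ ⟩
  p′ * q′ ∎

*-distribˡ-+ : ∀ p q r → p * (q + r) ≋ p * q + p * r
*-distribˡ-+ []      q r = ≋-refl
*-distribˡ-+ (a ∷ p) q r = begin
  scale a (q + r) + (0ℤ ∷ p * (q + r))
    ≈⟨ +-cong (scale-+ a q r) (∷-cong ≡.refl (*-distribˡ-+ p q r)) ⟩
  (scale a q + scale a r) + ((0ℤ ∷ p * q) + (0ℤ ∷ p * r))
    ≈⟨ interchange (scale a q) (scale a r) (0ℤ ∷ p * q) (0ℤ ∷ p * r) ⟩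
  (a ∷ p) * q + (a ∷ p) * r
    ∎

*-distribʳ-+ : ∀ r p q → (p + q) * r ≋ p * r + q * r
*-distribʳ-+ r p q = begin
  (p + q) * r   ≈⟨ *-comm (p + q) r ⟩
  r * (p + q)   ≈⟨ *-distribˡ-+ r p q ⟩
  r * p + r * q ≈⟨ +-cong (*-comm r p) (*-comm r q) ⟩
  p * r + q * r ∎

scale-* : ∀ a p q → scale a p * q ≋ scale a (p * q)
scale-* a []      q = ≋-refl
scale-* a (b ∷ p) q = begin
  scale (a ℤ.* b) q + (0ℤ ∷ scale a p * q)
    ≈⟨ +-cong (≋-sym (scale-scale a b q)) (∷-cong (≡.sym (ℤ.*-zeroʳ a)) (scale-* a p q)) ⟩
  scale a (scale b q) + scale a (0ℤ ∷ p * q)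
    ≈⟨ scale-+ a (scale b q) (0ℤ ∷ p * q) ⟨
  scale a ((b ∷ p) * q)
    ∎

*-assoc : ∀ p q r → (p * q) * r ≋ p * (q * r)
*-assoc []      q r = ≋-refl
*-assoc (a ∷ p) q r = begin
  (scale a q + (0ℤ ∷ p * q)) * r
    ≈⟨ *-distribʳ-+ r (scale a q) (0ℤ ∷ p * q) ⟩
  scale a q * r + (scale 0ℤ r + (0ℤ ∷ (p * q) * r))
    -- The summand `scale 0ℤ r` comes from the leading zero of the shifted factor `0ℤ ∷ p * q`.
    ≈⟨ +-cong (scale-* a q r) (+-cong (scale-0 r) (∷-cong ≡.refl (*-assoc p q r))) ⟩
  scale a (q * r) + (0ℤ ∷ p * (q * r))
    ∎

*-identityˡ : ∀ p → const 1 * p ≋ p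
*-identityˡ p = ≋-trans (+-cong (scale-1 p) ≋-refl) (+-identityʳ p)

ℤ[x] : CommutativeSemiring _ _
ℤ[x] = record
  { isCommutativeSemiring = isCommutativeSemiringʳ (record
    { +-isCommutativeMonoid = +-isCommutativeMonoid
    ; *-isCommutativeMonoid = record
      { isMonoid = record
        { isSemigroup = record
          { isMagma = record
            { isEquivalence = CommutativeMonoid.isEquivalence +-commutativeMonoid
            ; ∙-cong        = *-cong
            }
          ; assoc = *-assoc
          }
        ; identity = *-identityˡ , λ p → ≋-trans (*-comm p (const 1)) (*-identityˡ p)
        }
      ; comm = *-comm
      }
    ; distribˡ = *-distribˡ-+
    ; zeroʳ    = λ p → ≋-trans (*-congˡ p 0∷[]≋[]) (≋-trans (*-[] p) (≋-sym 0∷[]≋[]))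
    })
  }

-- The hook formula for polynomials

open Weighted ℤ[x] using (ι; ∑-cong; ∏-cong; hookFormula)

-- `const 1 + const n` computes to `const (suc n)`, so the equality is propositional and not merely
-- up to `≋`.
const≡ι : ∀ n → const n ≡ ι n
const≡ι zero    = ≡.refl
const≡ι (suc n) = cong (λ p → const 1 + p) (const≡ι n)

mainTheorem2 : ∀ (r : ℕ) → r ≥ 1 →
    ∑ (allTrees r) (λ T → ∏ (allFin r) (λ v → x * const (h T v) + const 1))
    ≈ (x + const 1) * ∏ (upTo (r ∸ 1)) (λ j → const r * x + const (suc j))
mainTheorem2 (suc n) _ = coeff-≡ (begin
  ∑ (allTrees (suc n)) (λ T → ∏ (allFin (suc n)) (λ v → x * const (h T v) + const 1))
    ≈⟨ ∑-cong (allTrees (suc n)) (λ T → ∏-cong (allFin (suc n)) (λ v →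
         ≋-reflexive (cong (λ c → x * c + const 1) (const≡ι (h T v))))) ⟩
  ∑ (allTrees (suc n)) (λ T → ∏ (allFin (suc n)) (λ v → x * ι (h T v) + const 1))
    ≈⟨ hookFormula n x ⟩
  (x + const 1) * ∏ (upTo n) (λ j → ι (suc n) * x + ι (suc j))
    ≈⟨ *-congˡ (x + const 1) (∏-cong (upTo n) (λ j →
         ≋-reflexive (cong₂ (λ c d → c * x + d) (const≡ι (suc n)) (const≡ι (suc j))))) ⟨
  (x + const 1) * ∏ (upTo n) (λ j → const (suc n) * x + const (suc j))
    ∎)
  where open CommutativeMonoid +-commutativeMonoid using () renaming (reflexive to ≋-reflexive)
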